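{- Let $m,n\ge 0$ be integers with $(m,n)\neq(0,1)$, and let $\mathcal{O}$ be the family of outerplanar graphs. Then $\omega_{a(m,n)}(\mathcal{O})=\omega_{r(m,n)}(\mathcal{O})=3(2m+n)+1$.
   Context: An $(m,n)$-colored mixed graph has arcs colored with $m$ colors and edges colored with $n$ colors, with simple underlying undirected graph. A homomorphism $f:G\to H$ maps vertices to vertices so that every arc (resp. edge) $uv$ of color $c$ is sent to an arc (resp. edge) $f(u)f(v)$ of color $c$ (arcs keep direction). $\chi_{(m,n)}(G)$ is the minimum order of an $H$ with $G\to H$; $G$ is an $(m,n)$-clique if $\chi_{(m,n)}(G)=|V(G)|$. For an $(m,n)$-colored mixed graph $G$, $\omega_{a(m,n)}(G)$ is the maximum order of a subgraph of $G$ that is an $(m,n)$-clique; a relative $(m,n)$-clique of $G$ is a vertex set $R$ such that no two distinct vertices of $R$ have the same image under any homomorphism of $G$ to any $(m,n)$-colored mixed graph, and $\omega_{r(m,n)}(G)$ is the maximum size of a relative $(m,n)$-clique of $G$. For an undirected simple graph $G$, $\omega_{a(m,n)}(G)$ (resp. $\omega_{r(m,n)}(G)$) is the maximum of the corresponding parameter over all $(m,n)$-colored mixed graphs with underlying graph $G$, and for a family $\mathcal{F}$ of graphs it is the maximum over all $G\in\mathcal{F}$. -}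

module Defs where

open import Data.Nat using (ℕ; _≤_; _<_)
open import Data.Fin using (Fin; toℕ)
open import Data.Product using (Σ; ∃; _×_; _,_)
open import Data.Sum using (_⊎_)
open import Relation.Nullary using (¬_)
open import Relation.Binary.PropositionalEquality using (_≡_; _≢_)
open import Function.Definitions using (Injective)

-- (m,n)-colored mixed graphs on the vertex set Fin k.
-- For an ordered pair (u,v) the label says: no adjacency, an edge of
-- colour c ∈ Fin n, an arc u→v of colour c ∈ Fin m (arc⁺ c), or an arc
-- v→u of colour c (arc⁻ c).

data Adj (m n : ℕ) : Set where
  none : Adj m n
  edge : Fin n → Adj m n
  arc⁺ : Fin m → Adj m n
  arc⁻ : Fin m → Adj m n

rev : ∀ {m n} → Adj m n → Adj m n
rev none     = none
rev (edge c) = edge c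
rev (arc⁺ c) = arc⁻ c
rev (arc⁻ c) = arc⁺ c

record MixedGraph (m n k : ℕ) : Set where
  field
    col      : Fin k → Fin k → Adj m n
    loopless : ∀ u → col u u ≡ none
    sym      : ∀ u v → col v u ≡ rev (col u v)
open MixedGraph public

IsHom : ∀ {m n k l} → MixedGraph m n k → MixedGraph m n l → (Fin k → Fin l) → Set
IsHom G H f = ∀ u v → col G u v ≢ none → col H (f u) (f v) ≡ col G u v

-- G is an (m,n)-clique: χ_(m,n)(G) = |V(G)|, i.e. every mixed graph H
-- admitting a homomorphism from G has at least |V(G)| vertices.
IsClique : ∀ {m n k} → MixedGraph m n k → Set
IsClique {m} {n} {k} G =
  ∀ l (H : MixedGraph m n l) (f : Fin k → Fin l) → IsHom G H f → k ≤ l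

record Subgraph {m n k} (G : MixedGraph m n k) (r : ℕ) : Set where
  field
    emb     : Fin r → Fin k
    emb-inj : Injective _≡_ _≡_ emb
    S       : MixedGraph m n r
    sub     : ∀ i j → col S i j ≡ none ⊎ col S i j ≡ col G (emb i) (emb j)
open Subgraph public

HasAbsClique : ∀ {m n k} → MixedGraph m n k → ℕ → Set
HasAbsClique G r = Σ (Subgraph G r) λ s → IsClique (S s)

IsRelClique : ∀ {m n k r} → MixedGraph m n k → (Fin r → Fin k) → Set
IsRelClique {m} {n} {k} {r} G ι =
  Injective _≡_ _≡_ ι ×
  (∀ l (H : MixedGraph m n l) (f : Fin k → Fin l) → IsHom G H f →
     ∀ i j → i ≢ j → f (ι i) ≢ f (ι j))

HasRelClique : ∀ {m n k} → MixedGraph m n k → ℕ → Set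
HasRelClique {k = k} G r = Σ (Fin r → Fin k) λ ι → IsRelClique G ι

record Graph (k : ℕ) : Set₁ where
  field
    E       : Fin k → Fin k → Set
    E-sym   : ∀ {u v} → E u v → E v u
    E-irr   : ∀ {u} → ¬ E u u
open Graph public

Underlying : ∀ {m n k} → MixedGraph m n k → Graph k
Underlying G = record
  { E     = λ u v → col G u v ≢ none
  ; E-sym = λ {u} {v} h eq → h (lem u v eq)
  ; E-irr = λ {u} h → h (loopless G u)
  }
  where
  open import Relation.Binary.PropositionalEquality using (trans; sym; cong)
  rev-none : ∀ {m n} (a : Adj m n) → rev a ≡ none → a ≡ none
  rev-none none _ = _≡_.refl
  rev-none (edge c) ()
  rev-none (arc⁺ c) ()
  rev-none (arc⁻ c) ()
  lem : ∀ u v → col G v u ≡ none → col G u v ≡ none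
  lem u v eq = rev-none _ (trans (Relation.Binary.PropositionalEquality.sym (MixedGraph.sym G u v)) eq)

-- Outerplanar: the vertices can be placed in convex position (around a
-- circle, in the cyclic order given by the injective map pos) so that no
-- two edges cross, i.e. there are no edges ab, cd with
-- pos a < pos c < pos b < pos d.
Outerplanar : ∀ {k} → Graph k → Set
Outerplanar {k} Γ =
  Σ (Fin k → Fin k) λ pos →
    Injective _≡_ _≡_ pos ×
    (∀ a b c d → E Γ a b → E Γ c d →
       ¬ (toℕ (pos a) < toℕ (pos c) × toℕ (pos c) < toℕ (pos b) × toℕ (pos b) < toℕ (pos d)))

AbsCliqueInO : ℕ → ℕ → ℕ → Set
AbsCliqueInO m n r =
  Σ ℕ λ k → Σ (MixedGraph m n k) λ G → Outerplanar (Underlying G) × HasAbsClique G r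

RelCliqueInO : ℕ → ℕ → ℕ → Set
RelCliqueInO m n r =
  Σ ℕ λ k → Σ (MixedGraph m n k) λ G → Outerplanar (Underlying G) × HasRelClique G r

IsMax : (ℕ → Set) → ℕ → Set
IsMax P N = P N × (∀ r → P r → r ≤ N)

{-# OPTIONS --safe #-}

-- Merging two vertices that are neither adjacent nor the ends of a 2-path with different labels
-- is a homomorphism, so any two members of a (relative or absolute) clique are "near" in this sense.
-- In convex position, a chord u v meets every 2-path between its two sides in u or v. If two
-- chords v b and v c both separate a from d, then a path from a to d must go through v; hence
-- (i) at most three members of a clique R see v through a given label, which bounds the degree of v
-- in R by 3 p with p = 2 m + n, and (ii) a vertex with four neighbours in R dominates R as soon as
-- |R| ≥ 8. If |R| ≥ 8, take r₀ … r₇ in cyclic order: the adjacency or 2-path from r₀ to r₄ separates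
-- r₁ r₂ r₃ from r₅ r₆ r₇, so by pigeonhole one of its vertices has four neighbours in R and dominates
-- R, whence |R| ≤ 3 p + 1. If |R| ≤ 7, this holds trivially for p ≥ 2, and for p = 0 there are no edges.
-- The bound is attained by a fan.

module Submission where

open import Defs renaming (sym to col-sym)
open import Data.Bool using (Bool; true; false)
open import Data.Nat using (ℕ; zero; suc; _+_; _*_; _≤_; _<_; _<?_; _≤?_; z≤n; s≤s)
open import Data.Nat.Properties
  using (<-cmp; <-trans; ≤-trans; <-≤-trans; <-irrefl; <-asym; ≮⇒≥; ≰⇒>; <⇒≱; <⇒≢; ≤∧≢⇒<; ≤-pred;
         ≤-reflexive; ≤-decTotalOrder; +-cancelˡ-<; +-cancelˡ-≡; m≤m+n; n≤1+n; +-suc; +-mono-≤;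
         *-comm; +-comm; suc-injective; module ≤-Reasoning)
open import Data.Fin using (Fin; zero; suc; toℕ; _≟_; _↑ˡ_; _↑ʳ_; inject≤; punchIn; punchOut)
import Data.Fin as Fin
open import Data.Fin.Patterns
import Data.Fin.Properties as Fin
open import Data.Fin.Properties
  using (any?; all?; ¬∀⟶∃¬; pigeonhole; injective⇒≤; toℕ-injective; toℕ<n; punchIn-punchOut)
open import Data.List using (List; []; _∷_; length; filter; lookup; map; tabulate; allFin; _++_)
open import Data.List.Properties using (length-tabulate; length-map; length-++)
open import Data.List.Membership.Propositional using (_∈_; _∉_)
open import Data.List.Membership.Propositional.Properties
  using (∈-allFin; ∈-map⁺; ∈-map⁻; ∈-++⁺ˡ; ∈-++⁺ʳ; ∈-++⁻; ∈-filter⁻; ∈-lookup)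
import Data.List.Membership.DecPropositional as DecMembership
open import Data.List.Relation.Unary.Any using (here; there; index)
open import Data.List.Relation.Unary.Any.Properties using (lookup-index)
open import Data.List.Relation.Unary.All using (All; []; _∷_)
import Data.List.Relation.Unary.All as All
import Data.List.Relation.Unary.All.Properties as All
open import Data.List.Relation.Unary.AllPairs using (AllPairs; []; _∷_)
import Data.List.Relation.Unary.AllPairs as AllPairs
open import Data.List.Relation.Unary.Linked.Properties using (Linked⇒AllPairs)
open import Data.List.Relation.Unary.Unique.Propositional using (Unique)
import Data.List.Relation.Unary.Unique.Propositional.Properties as Unique
import Data.List.Relation.Unary.Unique.DecPropositional as DecUnique
open import Data.List.Relation.Binary.Permutation.Propositional using (↭-sym; ↭⇒↭ₛ)
open import Data.List.Relation.Binary.Permutation.Propositional.Properties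
  using (↭-length; All-resp-↭)
import Data.List.Relation.Binary.Permutation.Setoid.Properties as Permutation
import Data.List.Sort as Sort
open import Data.Product using (∃; ∃₂; _×_; _,_; proj₁; proj₂)
open import Data.Sum using (_⊎_; inj₁; inj₂; [_,_]′)
import Data.Sum as Sum
open import Data.Vec using ([]; _∷_)
import Data.Vec as Vec
open import Function using (_∘_; id)
open import Function.Definitions using (Injective)
open import Relation.Binary using (tri<; tri≈; tri>; DecidableEquality)
import Relation.Binary.Construct.On as On
open import Relation.Binary.PropositionalEquality
  using (_≡_; _≢_; refl; sym; trans; cong; cong₂; subst; subst₂; setoid; ≢-sym)
open import Relation.Nullary using (¬_; Dec; yes; no; contradiction)
open import Relation.Nullary.Decidable
  using (_→-dec_; _×-dec_; _⊎-dec_; ¬?; map′; from-yes; decidable-stable)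

private variable
  m n k r : ℕ
  A : Set

-- Counting in lists without repetition.

lookup-AllPairs : ∀ {R : A → A → Set} {xs} → AllPairs R xs → ∀ {i j} → i Fin.< j → R (lookup xs i) (lookup xs j)
lookup-AllPairs (x ∷ _)  {0F}    {suc j} _         = All.lookup x (∈-lookup j)
lookup-AllPairs (_ ∷ xs) {suc _} {suc _} (s≤s i<j) = lookup-AllPairs xs i<j

lookup-injective : ∀ {xs : List A} → Unique xs → Injective _≡_ _≡_ (lookup xs)
lookup-injective u {i} {j} eq with Fin.<-cmp i j
... | tri< i<j _ _ = contradiction eq (lookup-AllPairs u i<j)
... | tri≈ _ i≡j _ = i≡j
... | tri> _ _ j<i = contradiction (sym eq) (lookup-AllPairs u j<i)

module _ (_≟ᴬ_ : DecidableEquality A) where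
  open DecMembership _≟ᴬ_ using (_∈?_)

  -- If every `s i` were in `xs`, sending `i` to its position there would map `Fin k` into fewer
  -- than `k` places, and two entries of `s` would coincide.
  fresh : {s : Fin k → A} → Injective _≡_ _≡_ s → ∀ xs → length xs < k → ∃ λ i → s i ∉ xs
  fresh {k} {s} s-inj xs short = ¬∀⟶∃¬ k (λ i → s i ∈ xs) (λ i → s i ∈? xs) λ all →
    let i , j , i<j , eq = pigeonhole short (index ∘ all)
    in <⇒≢ i<j (cong toℕ (s-inj (trans (lookup-index (all i))
                 (trans (cong (lookup xs) eq) (sym (lookup-index (all j)))))))

module _ {P : A → Set} (P? : ∀ x → Dec (P x)) where

  length-filter-∁ : ∀ xs → length (filter P? xs) + length (filter (¬? ∘ P?) xs) ≡ length xs
  length-filter-∁ []       = refl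
  length-filter-∁ (x ∷ xs) with P? x
  ... | yes _ = cong suc (length-filter-∁ xs)
  ... | no  _ = trans (+-suc _ _) (cong suc (length-filter-∁ xs))

module _ {B : Set} (_≟ᴮ_ : DecidableEquality B) (f : A → B) where

  -- Induction on `bs`: the fibre over the first value is filtered out, and the remaining elements
  -- take only the remaining values. It serves to count neighbours by label.
  length-fibres : ∀ c bs xs → (∀ {x} → x ∈ xs → f x ∈ bs) →
                  (∀ {b ys} → b ∈ bs → Unique ys → All (λ y → f y ≡ b × y ∈ xs) ys → length ys ≤ c) →
                  Unique xs → length xs ≤ length bs * c
  length-fibres c [] [] _ _ _ = z≤n
  length-fibres c [] (x ∷ xs) f∈ _ _ with () ← f∈ (here refl)
  length-fibres c (b ∷ bs) xs f∈ small u = begin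
    length xs                                     ≡⟨ length-filter-∁ b? xs ⟨
    length (filter b? xs) + length rest           ≤⟨ +-mono-≤ head tail ⟩
    c + length bs * c                             ∎
    where
    open ≤-Reasoning
    b?   = λ x → f x ≟ᴮ b
    rest = filter (¬? ∘ b?) xs
    head : length (filter b? xs) ≤ c
    head = small (here refl) (Unique.filter⁺ b? u)
                 (All.tabulate λ y∈ → let y∈xs , eq = ∈-filter⁻ b? y∈ in eq , y∈xs)
    tail : length rest ≤ length bs * c
    tail = length-fibres c bs rest
      (λ x∈ → let x∈xs , fx≢b = ∈-filter⁻ (¬? ∘ b?) x∈ in strip fx≢b (f∈ x∈xs))
      (λ b∈ u' all → small (there b∈) u' (All.map (λ (eq , y∈) → eq , proj₁ (∈-filter⁻ (¬? ∘ b?) y∈)) all))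
      (Unique.filter⁺ (¬? ∘ b?) u)
      where
      strip : ∀ {y} → y ≢ b → y ∈ b ∷ bs → y ∈ bs
      strip y≢b (here y≡b) = contradiction y≡b y≢b
      strip _   (there y∈) = y∈

-- Adjacency labels and their number.

infix 4 _≟ᴸ_
_≟ᴸ_ : DecidableEquality (Adj m n)
none   ≟ᴸ none   = yes refl
none   ≟ᴸ edge _ = no λ ()
none   ≟ᴸ arc⁺ _ = no λ ()
none   ≟ᴸ arc⁻ _ = no λ ()
edge _ ≟ᴸ none   = no λ ()
edge c ≟ᴸ edge d = map′ (cong edge) (λ { refl → refl }) (c ≟ d)
edge _ ≟ᴸ arc⁺ _ = no λ ()
edge _ ≟ᴸ arc⁻ _ = no λ ()
arc⁺ _ ≟ᴸ none   = no λ ()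
arc⁺ _ ≟ᴸ edge _ = no λ ()
arc⁺ c ≟ᴸ arc⁺ d = map′ (cong arc⁺) (λ { refl → refl }) (c ≟ d)
arc⁺ _ ≟ᴸ arc⁻ _ = no λ ()
arc⁻ _ ≟ᴸ none   = no λ ()
arc⁻ _ ≟ᴸ edge _ = no λ ()
arc⁻ _ ≟ᴸ arc⁺ _ = no λ ()
arc⁻ c ≟ᴸ arc⁻ d = map′ (cong arc⁻) (λ { refl → refl }) (c ≟ d)

-- All labels of an adjacent pair as seen from its first vertex. An arc colour contributes two of
-- them, one for each direction.
labels : ∀ m n → List (Adj m n)
labels m n = (map arc⁺ (allFin m) ++ map arc⁻ (allFin m)) ++ map edge (allFin n)

length-labels : ∀ m n → length (labels m n) ≡ 2 * m + n
length-labels m n = trans (length-++ (map arc⁺ (allFin m) ++ _))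
  (cong₂ _+_ (trans (length-++ (map arc⁺ (allFin m)))
                    (cong₂ _+_ (len m arc⁺) (trans (len m arc⁻) (sym (+-comm m 0)))))
             (len n edge))
  where
  len : ∀ {B : Set} k (f : Fin k → B) → length (map f (allFin k)) ≡ k
  len k f = trans (length-map f (allFin k)) (length-tabulate id)

labels-unique : ∀ m n → Unique (labels m n)
labels-unique m n = Unique.++⁺
  (Unique.++⁺ (Unique.map⁺ (λ { refl → refl }) (Unique.allFin⁺ m)) (Unique.map⁺ (λ { refl → refl }) (Unique.allFin⁺ m))
    λ (p , q) → case⁺⁻ (∈-map⁻ arc⁺ p) (∈-map⁻ arc⁻ q))
  (Unique.map⁺ (λ { refl → refl }) (Unique.allFin⁺ n))
  λ (p , q) → case-edge (∈-++⁻ (map arc⁺ (allFin m)) p) (∈-map⁻ edge q)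
  where
  case⁺⁻ : ∀ {x : Adj m n} → ∃ (λ c → c ∈ allFin m × x ≡ arc⁺ c) → ¬ ∃ λ c → c ∈ allFin m × x ≡ arc⁻ c
  case⁺⁻ (_ , _ , refl) (_ , _ , ())
  case-edge : ∀ {x : Adj m n} → x ∈ map arc⁺ (allFin m) ⊎ x ∈ map arc⁻ (allFin m) → ¬ ∃ λ c → c ∈ allFin n × x ≡ edge c
  case-edge (inj₁ p) (_ , _ , refl) with () ← proj₂ (proj₂ (∈-map⁻ arc⁺ p))
  case-edge (inj₂ p) (_ , _ , refl) with () ← proj₂ (proj₂ (∈-map⁻ arc⁻ p))

∈-labels : {x : Adj m n} → x ≢ none → x ∈ labels m n
∈-labels {x = none}   x≢none = contradiction refl x≢none
∈-labels {x = edge c} _ = ∈-++⁺ʳ _ (∈-map⁺ edge (∈-allFin c))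
∈-labels {x = arc⁺ c} _ = ∈-++⁺ˡ (∈-++⁺ˡ (∈-map⁺ arc⁺ (∈-allFin c)))
∈-labels {m} {x = arc⁻ c} _ = ∈-++⁺ˡ (∈-++⁺ʳ (map arc⁺ (allFin m)) (∈-map⁺ arc⁻ (∈-allFin c)))

labels-none : ∀ m n → All (_≢ none) (labels m n)
labels-none m n = All.++⁺
  (All.++⁺ (All.map⁺ {f = arc⁺} (All.universal (λ _ ()) (allFin m)))
           (All.map⁺ {f = arc⁻} (All.universal (λ _ ()) (allFin m))))
  (All.map⁺ {f = edge} (All.universal (λ _ ()) (allFin n)))

-- Nearness, non-crossing layouts and separation by chords.

module Chords (G : MixedGraph m n k) where

  infix 4 _~_
  _~_ : Fin k → Fin k → Set
  x ~ y = col G x y ≢ none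

  -- Both labels are read towards `w`. When they differ, no homomorphism identifies `x` and `y`,
  -- since the common image pair would carry two labels.
  Special : Fin k → Fin k → Fin k → Set
  Special x w y = x ~ w × y ~ w × col G x w ≢ col G y w

  Near : Fin k → Fin k → Set
  Near x y = x ~ y ⊎ ∃ λ w → Special x w y

  -- A convex position with keys in ℕ rather than `Fin k`, which allows both rotating it and
  -- restricting it to a subgraph.
  record Layout : Set where
    field
      key     : Fin k → ℕ
      key-inj : Injective _≡_ _≡_ key
      nc      : ∀ {a b c d} → a ~ b → c ~ d → key a < key c → key c < key b → ¬ key b < key d

  ~-sym : ∀ {x y} → x ~ y → y ~ x
  ~-sym = E-sym (Underlying G)

  ~-irr : ∀ {x} → ¬ x ~ x
  ~-irr = E-irr (Underlying G)

  Special-sym : ∀ {x w y} → Special x w y → Special y w x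
  Special-sym (xw , yw , ≢) = yw , xw , ≢-sym ≢

  Near-sym : ∀ {x y} → Near x y → Near y x
  Near-sym = Sum.map ~-sym λ (w , s) → w , Special-sym s

  ~? : ∀ x y → Dec (x ~ y)
  ~? x y = ¬? (col G x y ≟ᴸ none)

  Near? : ∀ x y → Dec (Near x y)
  Near? x y = ~? x y ⊎-dec any? λ w → ~? x w ×-dec ~? y w ×-dec ¬? (col G x w ≟ᴸ col G y w)

  module _ (Λ : Layout) (K : ℕ) (key<K : ∀ x → Layout.key Λ x < K) (v : Fin k) where
    open Layout Λ

    private
      Side : Bool → Fin k → Set
      Side true  x = key x < key v
      Side false x = key v ≤ key x

      -- A cyclic shift: `K` exceeds every key, so adding it moves the vertices before `v` behind
      -- all others.
      rot : Fin k → ℕ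
      rot x with key x <? key v
      ... | yes _ = K + key x
      ... | no  _ = key x

      -- The first index tells which x lie before v and are therefore moved behind all others.
      data Before : Bool → Bool → Fin k → Fin k → Set where
        same  : ∀ {s x y} → key x < key y → Before s s x y
        cross : ∀ {x y} → Before false true x y

      side : Fin k → Bool
      side x with key x <? key v
      ... | yes _ = true
      ... | no  _ = false

      toSide : ∀ x → Side (side x) x
      toSide x with key x <? key v
      ... | yes x<v = x<v
      ... | no  x≮v = ≮⇒≥ x≮v

      before : ∀ x y → rot x < rot y → Before (side x) (side y) x y
      before x y lt with key x <? key v | key y <? key v
      ... | yes _ | yes _ = same (+-cancelˡ-< K _ _ lt)
      ... | yes _ | no  _ = contradiction (<-trans lt (key<K y)) (λ K<K → <⇒≱ K<K (m≤m+n K _))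
      ... | no  _ | yes _ = cross
      ... | no  _ | no  _ = same lt

      rot-inj : Injective _≡_ _≡_ rot
      rot-inj {x} {y} eq with key x <? key v | key y <? key v
      ... | yes _ | yes _ = key-inj (+-cancelˡ-≡ K _ _ eq)
      ... | yes _ | no  _ = contradiction (key<K y) (λ lt → <⇒≱ lt (≤-trans (m≤m+n K _) (≤-reflexive eq)))
      ... | no  _ | yes _ = contradiction (key<K x) (λ lt → <⇒≱ lt (≤-trans (m≤m+n K _) (≤-reflexive (sym eq))))
      ... | no  _ | no  _ = key-inj eq

      -- Along `a`, `c`, `b`, `d` the rotated order passes from unmoved to moved vertices at most
      -- once. Undoing the rotation shifts the four cyclically, and a cyclic shift of a crossing is
      -- again a crossing.
      rot-nc : ∀ {p q s t a b c d} → a ~ b → c ~ d →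
               Side p a → Side q c → Side s b → Side t d →
               Before p q a c → Before q s c b → ¬ Before s t b d
      rot-nc ab cd _ _ _ _ (same a<c) (same c<b) (same b<d) = nc ab cd a<c c<b b<d
      rot-nc ab cd v≤a _ _ d<v (same a<c) (same c<b) cross  = nc (~-sym cd) ab (<-≤-trans d<v v≤a) a<c c<b
      rot-nc ab cd v≤a _ _ d<v (same a<c) cross (same b<d)  = nc (~-sym ab) (~-sym cd) b<d (<-≤-trans d<v v≤a) a<c
      rot-nc ab cd v≤a _ _ d<v cross (same c<b) (same b<d)  = nc cd (~-sym ab) c<b b<d (<-≤-trans d<v v≤a)

    rotate : Layout
    rotate = record
      { key     = rot
      ; key-inj = rot-inj
      ; nc      = λ {a} {b} {c} {d} ab cd a<c c<b b<d →
          rot-nc ab cd (toSide a) (toSide c) (toSide b) (toSide d) (before a c a<c) (before c b c<b) (before b d b<d)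
      }

    -- With `v` in first place, its neighbours are linearly ordered around it and every chord from
    -- `v` starts at the least key.
    rotate-min : ∀ {x} → x ≢ v → Layout.key rotate v < Layout.key rotate x
    rotate-min {x} x≢v with key v <? key v | key x <? key v
    ... | yes v<v | _       = contradiction v<v (<-irrefl refl)
    ... | no  _   | yes _   = <-≤-trans (key<K v) (m≤m+n K _)
    ... | no  _   | no  x≮v = ≤∧≢⇒< (≮⇒≥ x≮v) (x≢v ∘ sym ∘ key-inj)

  module _ (Λ : Layout) where
    open Layout Λ

    infix 4 _≺_
    _≺_ : Fin k → Fin k → Set
    x ≺ y = key x < key y

    cmp : ∀ x y → x ≺ y ⊎ x ≡ y ⊎ y ≺ x
    cmp x y with <-cmp (key x) (key y)
    ... | tri< lt _ _ = inj₁ lt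
    ... | tri≈ _ eq _ = inj₂ (inj₁ (key-inj eq))
    ... | tri> _ _ gt = inj₂ (inj₂ gt)

    sorted : ∀ {P : Fin k → Set} {xs} → Unique xs → All P xs →
             ∃ λ ys → length ys ≡ length xs × AllPairs _≺_ ys × All P ys
    sorted {xs = xs} u p = sort xs , ↭-length (sort-↭ xs) ,
      AllPairs.zipWith (λ (x≤y , x≢y) → ≤∧≢⇒< x≤y (x≢y ∘ key-inj))
        (Linked⇒AllPairs ≤-trans (sort-↗ xs) , Permutation.Unique-resp-↭ (setoid _) (↭⇒↭ₛ (↭-sym (sort-↭ xs))) u) ,
      All-resp-↭ (↭-sym (sort-↭ xs)) p
      where open Sort (On.decTotalOrder ≤-decTotalOrder key)

    uncrossed : ∀ {u v x y} → u ~ v → u ≺ x → x ≺ v → y ≺ u ⊎ v ≺ y → ¬ x ~ y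
    uncrossed uv u<x x<v (inj₁ y<u) xy = nc (~-sym xy) uv y<u u<x x<v
    uncrossed uv u<x x<v (inj₂ v<y) xy = nc uv xy u<x x<v v<y

    -- An edge `x y` would cross the chord `u v`. So would one of the two edges of a 2-path whose
    -- middle vertex lies strictly on either side of the chord, which leaves only `u` and `v` as
    -- middle vertex.
    separate : ∀ {u v x y} → u ~ v → u ≺ x → x ≺ v → y ≺ u ⊎ v ≺ y → Near x y → Special x u y ⊎ Special x v y
    separate uv u<x x<v y-out (inj₁ xy) = contradiction xy (uncrossed uv u<x x<v y-out)
    separate {u} {v} uv u<x x<v y-out (inj₂ (w , s@(xw , yw , _))) with cmp w u
    ... | inj₁ w<u         = contradiction xw (uncrossed uv u<x x<v (inj₁ w<u))
    ... | inj₂ (inj₁ refl) = inj₁ s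
    ... | inj₂ (inj₂ u<w) with cmp w v
    ...   | inj₁ w<v         = contradiction (~-sym yw) (uncrossed uv u<w w<v y-out)
    ...   | inj₂ (inj₁ refl) = inj₂ s
    ...   | inj₂ (inj₂ v<w)  = contradiction xw (uncrossed uv u<x x<v (inj₂ v<w))

    -- v is the only common end of the two chords v b and v c, both of which separate a from d.
    fan : ∀ {v a b c d} → v ≺ a → a ≺ b → b ≺ c → c ≺ d → v ~ b → v ~ c → Near a d → Special a v d
    fan v<a a<b b<c c<d vb vc near with separate vb v<a a<b (inj₂ (<-trans b<c c<d)) near
    ... | inj₁ s            = s
    ... | inj₂ (_ , db , _) =
      contradiction (~-sym db) (uncrossed vc (<-trans v<a a<b) b<c (inj₂ c<d))

-- Finding a vertex with four neighbours in `R`.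

twoOfThree : {P Q : Fin 3 → Set} → (∀ i → P i ⊎ Q i) →
             (∃₂ λ i j → i ≢ j × P i × P j) ⊎ (∃₂ λ i j → i ≢ j × Q i × Q j)
twoOfThree h with h 0F | h 1F | h 2F
... | inj₁ p | inj₁ q | _      = inj₁ (0F , 1F , (λ ()) , p , q)
... | inj₁ p | inj₂ _ | inj₁ q = inj₁ (0F , 2F , (λ ()) , p , q)
... | inj₂ _ | inj₁ p | inj₁ q = inj₁ (1F , 2F , (λ ()) , p , q)
... | inj₂ p | inj₂ q | _      = inj₂ (0F , 1F , (λ ()) , p , q)
... | inj₂ p | inj₁ _ | inj₂ q = inj₂ (0F , 2F , (λ ()) , p , q)
... | inj₁ _ | inj₂ p | inj₂ q = inj₂ (1F , 2F , (λ ()) , p , q)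

firstOrRest : {P Q : Fin k → Set} → (∀ i → P i ⊎ Q i) → ∃ P ⊎ (∀ i → Q i)
firstOrRest {zero}  h = inj₂ λ ()
firstOrRest {suc _} h with h 0F | firstOrRest (h ∘ suc)
... | inj₁ p | _            = inj₁ (0F , p)
... | inj₂ _ | inj₁ (i , p) = inj₁ (suc i , p)
... | inj₂ q | inj₂ qs      = inj₂ λ { zero → q ; (suc i) → qs i }

other : ∀ (i : Fin 3) → ∃ λ j → j ≢ i
other 0F = 1F , λ ()
other 1F = 0F , λ ()
other 2F = 0F , λ ()

-- In s : Fin 8 → Fin k, the entries 0F and 1F are the ends of a chord or 2-path that separates
-- the triples s ∘ X and s ∘ Y.
X Y : Fin 3 → Fin 8
X i = 2 ↑ʳ (i ↑ˡ 3)
Y j = 5 ↑ʳ j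

open DecUnique (_≟_ {8}) using (unique?)

-- Decided by evaluation over all indices. An injective `s` turns such index lists into lists of
-- distinct neighbours.
unique-ends : ∀ i j → Unique (0F ∷ 1F ∷ X i ∷ Y j ∷ [])
unique-ends = from-yes (all? λ i → all? λ j → unique? (0F ∷ 1F ∷ X i ∷ Y j ∷ []))

unique-square : ∀ i i′ j j′ → i ≢ i′ → j ≢ j′ → Unique (X i ∷ X i′ ∷ Y j ∷ Y j′ ∷ [])
unique-square = from-yes (all? λ i → all? λ i′ → all? λ j → all? λ j′ →
  ¬? (i ≟ i′) →-dec ¬? (j ≟ j′) →-dec unique? (X i ∷ X i′ ∷ Y j ∷ Y j′ ∷ []))

module NearSets (G : MixedGraph m n k) (R : Fin k → Set) where
  open Chords G

  -- What remains of `Special` for counting the neighbours of `c`: the labels are forgotten.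
  Via : Fin k → Fin k → Fin k → Set
  Via c x y = c ~ x × c ~ y

  Special⇒Via : ∀ {x c y} → Special x c y → Via c x y
  Special⇒Via (xc , yc , _) = ~-sym xc , ~-sym yc

  -- To be read as "at least `l` neighbours in `R`".
  Neighbours : ℕ → Fin k → Set
  Neighbours l v = ∃ λ ys → length ys ≡ l × Unique ys × All (λ y → R y × v ~ y) ys

  module _ {s : Fin 8 → Fin k} (s-inj : Injective _≡_ _≡_ s) (s∈R : ∀ i → R (s i)) where

    neighbours : ∀ {v is} → Unique is → All (λ i → v ~ s i) is → Neighbours (length is) v
    neighbours {v} {is} u adj =
      map s is , length-map s is , Unique.map⁺ s-inj u , All.map⁺ (All.map (λ {i} a → s∈R i , a) adj)

    -- The three diagonal pairs `X i`, `Y i` suffice: two of them use the same end, which then sees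
    -- two vertices of each triple.
    chord-centre : (∀ i j → Via (s 0F) (s (X i)) (s (Y j)) ⊎ Via (s 1F) (s (X i)) (s (Y j))) → ∃ (Neighbours 4)
    chord-centre h with twoOfThree (λ i → h i i)
    ... | inj₁ (i , j , i≢j , (p , q) , (p′ , q′)) = s 0F , neighbours (unique-square i j i j i≢j i≢j) (p ∷ p′ ∷ q ∷ q′ ∷ [])
    ... | inj₂ (i , j , i≢j , (p , q) , (p′ , q′)) = s 1F , neighbours (unique-square i j i j i≢j i≢j) (p ∷ p′ ∷ q ∷ q′ ∷ [])

    -- If w is itself one of the Y j, only the other Y j′ are separated from the X i, but
    -- then w is a further neighbour of both ends.
    path-centre : ∀ {w} → w ~ s 0F → w ~ s 1F →
      (∀ i j → s (Y j) ≢ w →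
         Via w (s (X i)) (s (Y j)) ⊎ Via (s 0F) (s (X i)) (s (Y j)) ⊎ Via (s 1F) (s (X i)) (s (Y j))) →
      ∃ (Neighbours 4)
    path-centre {w} w0 w1 h with any? (λ j → s (Y j) ≟ w)
    ... | yes (j , refl) = go (firstOrRest λ i → h i j′ λ eq → j′≢j (Fin.↑ʳ-injective 5 _ _ (s-inj eq)))
      where
      j′ = proj₁ (other j)
      j′≢j = proj₂ (other j)
      finish : ∀ {c i i′} → i ≢ i′ → Via c (s (X i)) (s (Y j′)) → Via c (s (X i′)) (s (Y j′)) → s (Y j) ~ c →
               Neighbours 4 c
      finish i≢i′ (p , q) (p′ , _) jc = neighbours (unique-square _ _ _ _ i≢i′ j′≢j) (p ∷ p′ ∷ q ∷ ~-sym jc ∷ [])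
      go : (∃ λ i → Via w (s (X i)) (s (Y j′))) ⊎ (∀ i → Via (s 0F) (s (X i)) (s (Y j′)) ⊎ Via (s 1F) (s (X i)) (s (Y j′))) →
           ∃ (Neighbours 4)
      go (inj₁ (i , p , q)) = _ , neighbours (unique-ends i j′) (w0 ∷ w1 ∷ p ∷ q ∷ [])
      go (inj₂ rest) with twoOfThree rest
      ... | inj₁ (i , i′ , i≢i′ , p , q) = _ , finish i≢i′ p q w0
      ... | inj₂ (i , i′ , i≢i′ , p , q) = _ , finish i≢i′ p q w1
    -- If `w` serves some pair, it sees that pair and both ends. Otherwise all pairs go through the
    -- ends, as for a chord.
    ... | no ∄ with firstOrRest (λ i → firstOrRest λ j → h i j λ eq → ∄ (j , eq))
    ...   | inj₁ (i , j , p , q) = w , neighbours (unique-ends i j) (w0 ∷ w1 ∷ p ∷ q ∷ [])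
    ...   | inj₂ rest            = chord-centre rest

-- Central vertices and domination.

module Domination (G : MixedGraph m n k) (R : Fin k → Set) where
  open Chords G
  open NearSets G R

  -- For a cyclically ordered s, the 2-path from s 0F to s 4F has its middle vertex outside (σ) or
  -- inside (τ) the interval between them; the triple on the other side must be X.
  σ τ : Fin 8 → Fin 8
  σ = Vec.lookup (0F ∷ 4F ∷ 1F ∷ 2F ∷ 3F ∷ 5F ∷ 6F ∷ 7F ∷ [])
  τ = Vec.lookup (0F ∷ 4F ∷ 5F ∷ 6F ∷ 7F ∷ 1F ∷ 2F ∷ 3F ∷ [])

  σ-inj : ∀ i j → σ i ≡ σ j → i ≡ j
  σ-inj = from-yes (all? λ i → all? λ j → σ i ≟ σ j →-dec i ≟ j)

  τ-inj : ∀ i j → τ i ≡ τ j → i ≡ j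
  τ-inj = from-yes (all? λ i → all? λ j → τ i ≟ τ j →-dec i ≟ j)

  left right : Fin 8
  left  = 0F
  right = 4F

  σ-order : ∀ i → left Fin.< σ (X i) × σ (X i) Fin.< right × right Fin.< σ (Y i)
  σ-order = from-yes (all? λ i → left Fin.<? σ (X i) ×-dec σ (X i) Fin.<? right ×-dec right Fin.<? σ (Y i))

  τ-order : ∀ i → left Fin.< τ (Y i) × τ (Y i) Fin.< right × right Fin.< τ (X i)
  τ-order = from-yes (all? λ i → left Fin.<? τ (Y i) ×-dec τ (Y i) Fin.<? right ×-dec right Fin.<? τ (X i))

  module _ (near : ∀ {x y} → R x → R y → x ≢ y → Near x y) where

    module _ (Λ : Layout) {s : Fin 8 → Fin k} (s∈R : ∀ i → R (s i))
             (mono : ∀ {i j} → i Fin.< j → Layout.key Λ (s i) < Layout.key Λ (s j)) where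
      open Layout Λ

      mono⇒inj : Injective _≡_ _≡_ s
      mono⇒inj {i} {j} eq with Fin.<-cmp i j
      ... | tri< i<j _ _ = contradiction (cong key eq) (<⇒≢ (mono i<j))
      ... | tri≈ _ i≡j _ = i≡j
      ... | tri> _ _ j<i = contradiction (cong key (sym eq)) (<⇒≢ (mono j<i))

      near< : ∀ {i j} → i Fin.< j → Near (s i) (s j)
      near< i<j = near (s∈R _) (s∈R _) (Fin.<⇒≢ i<j ∘ mono⇒inj)

      σ-inside : ∀ i → key (s 0F) < key (s (σ (X i))) × key (s (σ (X i))) < key (s 4F)
      σ-inside i = let p , q , _ = σ-order i in mono p , mono q

      σ-outside : ∀ j → key (s 4F) < key (s (σ (Y j)))
      σ-outside j = mono (proj₂ (proj₂ (σ-order j)))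

      σ-near : ∀ i j → Near (s (σ (X i))) (s (σ (Y j)))
      σ-near i j = near< (Fin.<-trans (proj₁ (proj₂ (σ-order i))) (proj₂ (proj₂ (σ-order j))))

      τ-inside : ∀ j → key (s 0F) < key (s (τ (Y j))) × key (s (τ (Y j))) < key (s 4F)
      τ-inside j = let p , q , _ = τ-order j in mono p , mono q

      τ-outside : ∀ i → key (s 4F) < key (s (τ (X i)))
      τ-outside i = mono (proj₂ (proj₂ (τ-order i)))

      τ-near : ∀ i j → Near (s (τ (Y j))) (s (τ (X i)))
      τ-near i j = near< (Fin.<-trans (proj₁ (proj₂ (τ-order j))) (proj₂ (proj₂ (τ-order i))))

      -- An edge from `s 0F` to `s 4F` separates the triples itself. For a 2-path, the position of
      -- the middle vertex `w` decides which of its edges separates a given pair.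
      central-vertex : ∃ (Neighbours 4)
      central-vertex with near< {0F} {4F} (s≤s z≤n)
      ... | inj₁ e = chord-centre (σ-inj _ _ ∘ mono⇒inj) (s∈R ∘ σ) λ i j →
        let 0<x , x<4 = σ-inside i
        in Sum.map Special⇒Via Special⇒Via (separate Λ e 0<x x<4 (inj₂ (σ-outside j)) (σ-near i j))
      ... | inj₂ (w , 0w , 4w , _) with cmp Λ w (s 0F)
      ...   | inj₂ (inj₁ refl) = contradiction 0w ~-irr
      -- One edge suffices: the triple `X` lies between `w` and `s 4F`, all of `Y` behind `s 4F`.
      ...   | inj₁ w<0 = path-centre (σ-inj _ _ ∘ mono⇒inj) (s∈R ∘ σ) (~-sym 0w) (~-sym 4w) λ i j _ →
        let 0<x , x<4 = σ-inside i
        in Sum.map Special⇒Via (inj₂ ∘ Special⇒Via)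
             (separate Λ (~-sym 4w) (<-trans w<0 0<x) x<4 (inj₂ (σ-outside j)) (σ-near i j))
      ...   | inj₂ (inj₂ 0<w) with cmp Λ w (s 4F)
      ...     | inj₂ (inj₁ refl) = contradiction 4w ~-irr
      -- The inner triple is now `Y`: a vertex of it before `w` is cut off by the edge `s 0F` to
      -- `w`, one behind `w` by the edge `w` to `s 4F`.
      ...     | inj₁ w<4 = path-centre (τ-inj _ _ ∘ mono⇒inj) (s∈R ∘ τ) (~-sym 0w) (~-sym 4w) case
        where
        case : ∀ i j → s (τ (Y j)) ≢ w → _
        case i j y≢w with cmp Λ (s (τ (Y j))) w
        ... | inj₁ y<w = [ inj₂ ∘ inj₁ ∘ Special⇒Via ∘ Special-sym , inj₁ ∘ Special⇒Via ∘ Special-sym ]′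
                (separate Λ 0w (proj₁ (τ-inside j)) y<w (inj₂ (<-trans w<4 (τ-outside i))) (τ-near i j))
        ... | inj₂ (inj₁ y≡w) = contradiction y≡w y≢w
        ... | inj₂ (inj₂ w<y) = [ inj₁ ∘ Special⇒Via ∘ Special-sym , inj₂ ∘ inj₂ ∘ Special⇒Via ∘ Special-sym ]′
                (separate Λ (~-sym 4w) w<y (proj₂ (τ-inside j)) (inj₂ (τ-outside i)) (τ-near i j))
      -- A vertex of `Y` before `w` is cut off by the edge `s 4F` to `w`; for one behind `w`, the
      -- edge `s 0F` to `w` encloses the triple `X`.
      ...     | inj₂ (inj₂ 4<w) = path-centre (σ-inj _ _ ∘ mono⇒inj) (s∈R ∘ σ) (~-sym 0w) (~-sym 4w) case
        where
        case : ∀ i j → s (σ (Y j)) ≢ w → _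
        case i j y≢w with cmp Λ (s (σ (Y j))) w
        ... | inj₁ y<w = [ inj₂ ∘ inj₂ ∘ Special⇒Via ∘ Special-sym , inj₁ ∘ Special⇒Via ∘ Special-sym ]′
                (separate Λ 4w (σ-outside j) y<w (inj₁ (proj₂ (σ-inside i))) (Near-sym (σ-near i j)))
        ... | inj₂ (inj₁ y≡w) = contradiction y≡w y≢w
        ... | inj₂ (inj₂ w<y) = [ inj₂ ∘ inj₁ ∘ Special⇒Via , inj₁ ∘ Special⇒Via ]′
                (separate Λ 0w (proj₁ (σ-inside i)) (<-trans (proj₂ (σ-inside i)) 4<w) (inj₂ w<y) (σ-near i j))

    module _ (Λ : Layout) {v : Fin k} (v-min : ∀ {x} → x ≢ v → Layout.key Λ v < Layout.key Λ x) where
      open Layout Λ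

      ≢v : ∀ {x} → v ~ x → x ≢ v
      ≢v vx refl = ~-irr vx

      v≺ : ∀ {x} → v ~ x → key v < key x
      v≺ = v-min ∘ ≢v

      -- Before `b` or behind `c`, the vertex `x` would be separated from `d` or from `a` by both
      -- chords `v b` and `v c`, and `fan` would make it adjacent to `v`. Between them, the 2-path
      -- from `a` must pass the chord `v b` at `b`, and the one to `d` must pass `v c` at `c`.
      squeezed : ∀ {a b c d x} → AllPairs (λ p q → key p < key q) (a ∷ b ∷ c ∷ d ∷ []) →
                 All (λ y → R y × v ~ y) (a ∷ b ∷ c ∷ d ∷ []) → R x → x ≢ v → ¬ v ~ x →
                 (key b < key x × x ~ b) × (key x < key c × x ~ c)
      squeezed {a} {b} {c} {d} {x} ((a<b ∷ _) ∷ (b<c ∷ _) ∷ (c<d ∷ _) ∷ _)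
               ((Ra , va) ∷ (Rb , vb) ∷ (Rc , vc) ∷ (Rd , vd) ∷ []) Rx x≢v v≁x =
        (b<x , x~b) , (x<c , x~c)
        where
        not-nbr : ∀ {y} → v ~ y → y ≢ x
        not-nbr vy refl = v≁x vy
        b<x : key b < key x
        b<x with cmp Λ b x
        ... | inj₁ b<x        = b<x
        ... | inj₂ (inj₁ b≡x) = contradiction b≡x (not-nbr vb)
        ... | inj₂ (inj₂ x<b) = let xv , _ = fan Λ (v-min x≢v) x<b b<c c<d vb vc (near Rx Rd (≢-sym (not-nbr vd)))
                                in contradiction (~-sym xv) v≁x
        x<c : key x < key c
        x<c with cmp Λ x c
        ... | inj₁ x<c        = x<c
        ... | inj₂ (inj₁ x≡c) = contradiction (sym x≡c) (not-nbr vc)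
        ... | inj₂ (inj₂ c<x) = let _ , xv , _ = fan Λ (v≺ va) a<b b<c c<x vb vc (near Ra Rx (not-nbr va))
                                in contradiction (~-sym xv) v≁x
        x~b : x ~ b
        x~b with separate Λ vb (v≺ va) a<b (inj₂ b<x) (near Ra Rx (not-nbr va))
        ... | inj₁ (_ , xv , _) = contradiction (~-sym xv) v≁x
        ... | inj₂ (_ , xb , _) = xb
        x~c : x ~ c
        x~c with separate Λ vc (v-min x≢v) x<c (inj₂ c<d) (near Rx Rd (≢-sym (not-nbr vd)))
        ... | inj₁ (xv , _) = contradiction (~-sym xv) v≁x
        ... | inj₂ (xc , _) = xc

      -- Two such vertices share the gap between `b` and `c`, and each is adjacent to both `b` and
      -- `c`. The edge from `b` to the later one then crosses the edge from the earlier one to `c`.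
      non-neighbour-unique : ∀ {x y} → Neighbours 4 v → R x → x ≢ v → ¬ v ~ x → R y → y ≢ v → ¬ v ~ y → x ≡ y
      non-neighbour-unique {x} {y} (_ , len , u , N) Rx x≢v v≁x Ry y≢v v≁y with sorted Λ u N
      ... | ys , len′ , inc , N′ with ys | trans len′ len
      ... | _ ∷ _ ∷ _ ∷ _ ∷ [] | refl with squeezed inc N′ Rx x≢v v≁x | squeezed inc N′ Ry y≢v v≁y
      ... | (b<x , xb) , (x<c , xc) | (b<y , yb) , (y<c , yc) with cmp Λ x y
      ... | inj₁ x<y        = contradiction y<c (nc (~-sym yb) xc b<x x<y)
      ... | inj₂ (inj₁ x≡y) = x≡y
      ... | inj₂ (inj₂ y<x) = contradiction x<c (nc (~-sym xb) yc b<y y<x)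

      -- Squeezing by the first four neighbours puts `x` before the third neighbour, squeezing by
      -- the last four puts it behind.
      no-non-neighbour : ∀ {x} → Neighbours 5 v → R x → x ≢ v → v ~ x
      no-non-neighbour {x} (_ , len , u , N) Rx x≢v = decidable-stable (~? v x) λ v≁x → go v≁x (sorted Λ u N)
        where
        go : ¬ v ~ x → ¬ _
        go v≁x (ys , len′ , inc , N′) with ys | trans len′ len
        go v≁x (_ , _ , (a<b ∷ a<c ∷ a<d ∷ _) ∷ inc@((b<c ∷ b<d ∷ _) ∷ (c<d ∷ _) ∷ _) , Na ∷ N′@(Nb ∷ Nc ∷ Nd ∷ _))
          | _ ∷ _ ∷ _ ∷ _ ∷ _ ∷ [] | refl =
            let _ , x<c , _ = squeezed ((a<b ∷ a<c ∷ a<d ∷ []) ∷ (b<c ∷ b<d ∷ []) ∷ (c<d ∷ []) ∷ [] ∷ [])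
                                       (Na ∷ Nb ∷ Nc ∷ Nd ∷ []) Rx x≢v v≁x
                (c<x , _) , _ = squeezed inc N′ Rx x≢v v≁x
            in <-asym x<c c<x

      -- Some `z` of the eight avoids `v`, `x` and the four neighbours. If `v` sees `z`, it has five
      -- neighbours and no non-neighbour; if not, `z` and `x` are two distinct non-neighbours.
      dominates : ∀ {s : Fin 8 → Fin k} → Injective _≡_ _≡_ s → (∀ i → R (s i)) → Neighbours 4 v →
                  ∀ {x} → R x → x ≢ v → v ~ x
      dominates {s} s-inj s∈R N₄@(ys , len , u , N) {x} Rx x≢v = decidable-stable (~? v x) λ v≁x →
        let i , z∉ = fresh _≟_ s-inj (v ∷ x ∷ ys) (subst (λ l → suc (suc l) < 8) (sym len) (from-yes (6 <? 8)))
            z = s i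
            z≢v = z∉ ∘ here
        in case v≁x z∉
        where
        case : ¬ v ~ x → ∀ {i} → ¬ s i ∉ v ∷ x ∷ ys
        case v≁x {i} z∉ with ~? v (s i)
        ... | yes vz = v≁x (no-non-neighbour (s i ∷ ys , cong suc len ,
                          All.tabulate (λ y∈ z≡y → z∉ (there (there (subst (_∈ ys) (sym z≡y) y∈)))) ∷ u ,
                          (s∈R i , vz) ∷ N) Rx x≢v)
        ... | no v≁z = z∉ (there (here (non-neighbour-unique N₄ (s∈R i) (z∉ ∘ here) v≁z Rx x≢v v≁x)))

      -- Of four such vertices in order, the chords from `v` to the middle two separate the first
      -- from the last, so by `fan` these see `v` through different labels.
      label-class : ∀ {l ys} → Unique ys → All (λ y → col G v y ≡ l × R y × v ~ y) ys → length ys ≤ 3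
      label-class {ys = []}            _ _ = z≤n
      label-class {ys = _ ∷ []}        _ _ = s≤s z≤n
      label-class {ys = _ ∷ _ ∷ []}    _ _ = s≤s (s≤s z≤n)
      label-class {ys = _ ∷ _ ∷ _ ∷ []} _ _ = s≤s (s≤s (s≤s z≤n))
      label-class {l} {a ∷ b ∷ c ∷ d ∷ _} ((ab ∷ ac ∷ ad ∷ _) ∷ (bc ∷ bd ∷ _) ∷ (cd ∷ _) ∷ _) (pa ∷ pb ∷ pc ∷ pd ∷ _)
        with sorted Λ {xs = a ∷ b ∷ c ∷ d ∷ []} ((ab ∷ ac ∷ ad ∷ []) ∷ (bc ∷ bd ∷ []) ∷ (cd ∷ []) ∷ [] ∷ []) (pa ∷ pb ∷ pc ∷ pd ∷ [])
      ... | p ∷ q ∷ s ∷ t ∷ [] , refl , (p<q ∷ _ ∷ p<t ∷ []) ∷ (q<s ∷ _) ∷ (s<t ∷ _) ∷ _ ,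
            (lp , Rp , vp) ∷ (_ , _ , vq) ∷ (_ , _ , vs) ∷ (lt , Rt , vt) ∷ [] =
        let _ , _ , p≢t = fan Λ (v≺ vp) p<q q<s s<t vq vs (near Rp Rt (<⇒≢ p<t ∘ cong key))
        in contradiction (trans (col-sym G v p) (trans (cong rev (trans lp (sym lt))) (sym (col-sym G v t)))) p≢t

-- The bound for pairwise near vertices.

module NearBound (G : MixedGraph m n k) (Λ : Chords.Layout G) (K : ℕ)
  (key<K : ∀ x → Chords.Layout.key Λ x < K) {ι : Fin r → Fin k} (ι-inj : Injective _≡_ _≡_ ι)
  (near : ∀ {i j} → i ≢ j → Chords.Near G (ι i) (ι j)) where
  open Chords G
  open Layout Λ

  private
    R : Fin k → Set
    R x = ∃ λ i → ι i ≡ x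

    near-R : ∀ {x y} → R x → R y → x ≢ y → Near x y
    near-R (i , refl) (j , refl) x≢y = near (x≢y ∘ cong ι)

  open NearSets G R
  open Domination G R

  -- The centre `v` may lie in `R` or outside it, so the members are split into at most one copy of
  -- `v` and the rest, all adjacent to `v`, with at most three for each label.
  near-bound-large : 8 ≤ r → r ≤ suc (length (labels m n) * 3)
  near-bound-large 8≤r with sorted Λ {P = R} {xs = tabulate ι} (Unique.tabulate⁺ ι-inj) (All.tabulate⁺ (λ i → i , refl))
  ... | zs , len , inc , zs∈R = begin
    r                                                  ≡⟨ length-tabulate ι ⟨
    length (tabulate ι)                                ≡⟨ length-filter-∁ (_≟ v) (tabulate ι) ⟨
    length (filter (_≟ v) (tabulate ι)) + length rest  ≤⟨ +-mono-≤ (at-most-one (Unique.filter⁺ (_≟ v) u) (All.all-filter (_≟ v) (tabulate ι))) bound ⟩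
    suc (length (labels m n) * 3)                      ∎
    where
    open ≤-Reasoning
    8≤len : 8 ≤ length zs
    8≤len = subst (8 ≤_) (sym (trans len (length-tabulate ι))) 8≤r
    s : Fin 8 → Fin k
    s i = lookup zs (inject≤ i 8≤len)
    s∈R : ∀ i → R (s i)
    s∈R i = All.lookup zs∈R (∈-lookup (inject≤ i 8≤len))
    mono : ∀ {i j} → i Fin.< j → key (s i) < key (s j)
    mono {i} {j} i<j = lookup-AllPairs inc
      (subst₂ _<_ (sym (Fin.toℕ-inject≤ i 8≤len)) (sym (Fin.toℕ-inject≤ j 8≤len)) i<j)
    centre : ∃ (Neighbours 4)
    centre = central-vertex near-R Λ s∈R mono
    v : Fin k
    v = proj₁ centre
    Λᵥ : Layout
    Λᵥ = rotate Λ K key<K v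
    v-min : ∀ {x} → x ≢ v → _
    v-min = rotate-min Λ K key<K v
    dominated : ∀ {x} → R x → x ≢ v → v ~ x
    dominated = dominates near-R Λᵥ v-min (mono⇒inj near-R Λ s∈R mono) s∈R (proj₂ centre)
    u : Unique (tabulate ι)
    u = Unique.tabulate⁺ ι-inj
    rest : List (Fin k)
    rest = filter (¬? ∘ (_≟ v)) (tabulate ι)
    adjacent : ∀ {x} → x ∈ rest → R x × v ~ x
    adjacent x∈ with ∈-filter⁻ (¬? ∘ (_≟ v)) {xs = tabulate ι} x∈
    ... | x∈ι , x≢v = Rx , dominated Rx x≢v
      where Rx = All.lookup (All.tabulate⁺ {P = R} (λ i → i , refl)) x∈ι
    bound : length rest ≤ length (labels m n) * 3
    bound = length-fibres _≟ᴸ_ (col G v) 3 (labels m n) rest (∈-labels ∘ proj₂ ∘ adjacent)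
      (λ _ u′ all → label-class near-R Λᵥ v-min u′ (All.map (λ (eq , x∈) → eq , adjacent x∈) all))
      (Unique.filter⁺ (¬? ∘ (_≟ v)) u)
    at-most-one : ∀ {ys} → Unique ys → All (_≡ v) ys → length ys ≤ 1
    at-most-one {[]}        _ _ = z≤n
    at-most-one {_ ∷ []}    _ _ = s≤s z≤n
    at-most-one {_ ∷ _ ∷ _} ((x≢y ∷ _) ∷ _) (x≡v ∷ y≡v ∷ _) = contradiction (trans x≡v (sym y≡v)) x≢y

  near-bound : length (labels m n) ≢ 1 → r ≤ suc (length (labels m n) * 3)
  near-bound p≢1 with 8 ≤? r
  ... | yes 8≤r = near-bound-large 8≤r
  ... | no 8≰r with length (labels m n) in eq
  ...   | 1 = contradiction refl p≢1
  -- The bound computes to `7 + p * 3`.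
  ...   | suc (suc p) = ≤-trans (≤-pred (≰⇒> 8≰r)) (m≤m+n 7 (p * 3))
  ...   | 0 with 2 ≤? r
  ...     | no 2≰r = ≤-pred (≰⇒> 2≰r)
  ...     | yes (s≤s (s≤s _)) = contradiction (adjacency (near {0F} {1F} λ ())) λ (_ , _ , xy) → no-label eq (∈-labels xy)
    where
    adjacency : ∀ {x y} → Near x y → ∃₂ _~_
    adjacency (inj₁ xy)           = _ , _ , xy
    adjacency (inj₂ (_ , xw , _)) = _ , _ , xw
    no-label : ∀ {l : Adj m n} {ls} → length ls ≡ 0 → l ∉ ls
    no-label {ls = []} _ ()

-- Merging two vertices that are not near.

rev-involutive : (x : Adj m n) → rev (rev x) ≡ x
rev-involutive none     = refl
rev-involutive (edge _) = refl
rev-involutive (arc⁺ _) = refl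
rev-involutive (arc⁻ _) = refl

rev-≢none : {x : Adj m n} → x ≢ none → rev x ≢ none
rev-≢none x≢none eq = x≢none (trans (sym (rev-involutive _)) (cong rev eq))

infixr 6 _▹_
_▹_ : Adj m n → Adj m n → Adj m n
none ▹ y = y
x    ▹ _ = x

▹-identityʳ : (x : Adj m n) → x ▹ none ≡ x
▹-identityʳ none     = refl
▹-identityʳ (edge _) = refl
▹-identityʳ (arc⁺ _) = refl
▹-identityʳ (arc⁻ _) = refl

▹-left : {x : Adj m n} → x ≢ none → ∀ y → x ▹ y ≡ x
▹-left {x = none}   x≢none _ = contradiction refl x≢none
▹-left {x = edge _} _ _ = refl
▹-left {x = arc⁺ _} _ _ = refl
▹-left {x = arc⁻ _} _ _ = refl

▹-swap : (x y : Adj m n) → x ▹ y ▹ x ≡ x ▹ x ▹ y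
▹-swap none     y = ▹-identityʳ y
▹-swap (edge _) y = refl
▹-swap (arc⁺ _) y = refl
▹-swap (arc⁻ _) y = refl

rev-▹ : (x y : Adj m n) → rev (x ▹ y) ≡ rev x ▹ rev y
rev-▹ none     _ = refl
rev-▹ (edge _) _ = refl
rev-▹ (arc⁺ _) _ = refl
rev-▹ (arc⁻ _) _ = refl

-- In the target, u receives the adjacencies of v besides its own, and v remains as a vertex
-- outside the image.
module Merge (G : MixedGraph m n k) {u v : Fin k} (u≢v : u ≢ v) (¬near : ¬ Chords.Near G u v) where
  open Chords G

  col-uv : col G u v ≡ none
  col-uv = decidable-stable (col G u v ≟ᴸ none) (¬near ∘ inj₁)

  col-vu : col G v u ≡ none
  col-vu = trans (col-sym G u v) (cong rev col-uv)

  -- Away from `u` this is the identity, so that the extra terms of `colᴹ` merely repeat `col G x y`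
  -- there.
  also : Fin k → Fin k
  also x with x ≟ u
  ... | yes _ = v
  ... | no  _ = x

  also-u : also u ≡ v
  also-u with u ≟ u
  ... | yes _  = refl
  ... | no u≢u = contradiction refl u≢u

  colᴹ : Fin k → Fin k → Adj m n
  colᴹ x y = col G x y ▹ col G (also x) y ▹ col G x (also y)

  looplessᴹ : ∀ x → colᴹ x x ≡ none
  looplessᴹ x with x ≟ u
  ... | yes refl rewrite loopless G u | col-vu | col-uv = refl
  ... | no  _    rewrite loopless G x  = refl

  rev-colᴹ : ∀ x y → rev (colᴹ x y) ≡ col G y x ▹ col G y (also x) ▹ col G (also y) x
  rev-colᴹ x y = trans (rev-▹ (col G x y) _)
    (cong₂ _▹_ (sym (col-sym G x y)) (trans (rev-▹ (col G (also x) y) _)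
      (cong₂ _▹_ (sym (col-sym G (also x) y)) (sym (col-sym G x (also y))))))

  -- Although `_▹_` is not commutative, one of the two extra terms repeats `col G y x` unless `x`
  -- and `y` are both `u`; in that case both extra terms are `none`.
  swap : ∀ x y → col G y x ▹ col G (also y) x ▹ col G y (also x) ≡ col G y x ▹ col G y (also x) ▹ col G (also y) x
  swap x y with x ≟ u | y ≟ u
  ... | yes refl | yes refl rewrite col-vu | col-uv = refl
  ... | no _     | _        = ▹-swap (col G y x) _
  ... | yes refl | no _     = sym (▹-swap (col G y u) _)

  merged : MixedGraph m n k
  merged = record { col = colᴹ ; loopless = looplessᴹ ; sym = λ x y → trans (swap x y) (sym (rev-colᴹ x y)) }

  merge : Fin k → Fin k
  merge x with x ≟ v
  ... | yes _ = u
  ... | no  _ = x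

  merge-≢v : ∀ x → merge x ≢ v
  merge-≢v x with x ≟ v
  ... | yes _  = u≢v
  ... | no x≢v = x≢v

  merge-identifies : merge u ≡ merge v
  merge-identifies with u ≟ v | v ≟ v
  ... | yes u≡v | _      = contradiction u≡v u≢v
  ... | no _    | yes _  = refl
  ... | no _    | no v≢v = contradiction refl v≢v

  -- If `u` has its own adjacency to `y`, that label prevails. It agrees with the label from `v`, as
  -- otherwise `y` would make `u` and `v` near.
  colᴹ-u : ∀ y → v ~ y → colᴹ u y ≡ col G v y
  colᴹ-u y vy with col G u y ≟ᴸ none
  ... | yes eq rewrite eq | also-u = ▹-left vy _
  ... | no  uy = trans (▹-left uy _) (decidable-stable (col G u y ≟ᴸ col G v y) λ ≢ → ¬near (inj₂ (y , uy , vy , ≢)))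

  merge-hom : IsHom G merged merge
  merge-hom x y xy with x ≟ v | y ≟ v
  ... | yes refl | yes refl = contradiction xy ~-irr
  ... | yes refl | no _     = colᴹ-u y xy
  ... | no _     | yes refl = trans (MixedGraph.sym merged u x)
    (trans (cong rev (colᴹ-u x (~-sym xy))) (sym (col-sym G v x)))
  ... | no _     | no _     = ▹-left xy _

-- Cliques and nearness.

relClique⇒Near : (G : MixedGraph m n k) {ι : Fin r → Fin k} → IsRelClique G ι → ∀ {i j} → i ≢ j → Chords.Near G (ι i) (ι j)
relClique⇒Near {k = k} G {ι} (ι-inj , distinct) {i} {j} i≢j = decidable-stable (Chords.Near? G (ι i) (ι j)) λ ¬near →
  let open Merge G (i≢j ∘ ι-inj) ¬near
  in distinct k merged merge merge-hom i j i≢j merge-identifies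

-- The image of `merge` avoids `y`, so deleting `y` from the merged graph leaves a target with one
-- vertex fewer than `G`.
clique⇒Near : (G : MixedGraph m n k) → IsClique G → ∀ {x y} → x ≢ y → Chords.Near G x y
clique⇒Near {k = suc k} G clique {x} {y} x≢y = decidable-stable (Chords.Near? G x y) λ ¬near →
  let open Merge G x≢y ¬near
      H = record
        { col      = λ a b → colᴹ (punchIn y a) (punchIn y b)
        ; loopless = λ a → looplessᴹ (punchIn y a)
        ; sym      = λ a b → MixedGraph.sym merged (punchIn y a) (punchIn y b)
        }
      f = λ a → punchOut (≢-sym (merge-≢v a))
      hom : IsHom G H f
      hom a b ab = trans (cong₂ colᴹ (punchIn-punchOut (≢-sym (merge-≢v a))) (punchIn-punchOut (≢-sym (merge-≢v b))))
                         (merge-hom a b ab)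
  in <-irrefl refl (clique k H f hom)

-- Adjacent vertices cannot be identified because the target has no loops, the ends of a special
-- 2-path because their labels towards the middle are preserved.
Near-all⇒hom-injective : (G : MixedGraph m n k) → (∀ {x y} → x ≢ y → Chords.Near G x y) →
                         ∀ {l} (H : MixedGraph m n l) {f} → IsHom G H f → Injective _≡_ _≡_ f
Near-all⇒hom-injective G near H {f} hom {x} {y} fx≡fy = decidable-stable (x ≟ y) λ x≢y → go (near x≢y)
  where
  go : ¬ Chords.Near G x y
  go (inj₁ xy) = xy (trans (sym (hom x y xy)) (trans (cong (col H (f x)) (sym fx≡fy)) (loopless H (f x))))
  go (inj₂ (w , xw , yw , ≢)) = ≢ (trans (sym (hom x w xw)) (trans (cong (λ z → col H z (f w)) fx≡fy) (hom y w yw)))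

-- Upper bounds for outerplanar graphs.

layout : (G : MixedGraph m n k) → Outerplanar (Underlying G) → Chords.Layout G
layout G (pos , pos-inj , nc) = record
  { key     = toℕ ∘ pos
  ; key-inj = pos-inj ∘ toℕ-injective
  ; nc      = λ {a} {b} {c} {d} ab cd a<c c<b b<d → nc a b c d ab cd (a<c , c<b , b<d)
  }

sublayout : {G : MixedGraph m n k} (H : Subgraph G r) → Chords.Layout G → Chords.Layout (S H)
sublayout H Λ = record
  { key     = key ∘ emb H
  ; key-inj = emb-inj H ∘ key-inj
  ; nc      = λ ab cd → nc (lift ab) (lift cd)
  }
  where
  open Chords.Layout Λ
  lift : ∀ {i j} → col (S H) i j ≢ none → _
  lift {i} {j} ij eq with sub H i j
  ... | inj₁ absent = ij absent
  ... | inj₂ same = ij (trans same eq)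

relClique-bound : length (labels m n) ≢ 1 → RelCliqueInO m n r → r ≤ suc (length (labels m n) * 3)
relClique-bound p≢1 (k , G , outer , ι , clique) =
  NearBound.near-bound G (layout G outer) k (λ x → toℕ<n (proj₁ outer x))
    (proj₁ clique) (relClique⇒Near G clique) p≢1

-- The bound is applied to the subgraph itself, with all its vertices as the near set, because the
-- 2-paths that make them near lie inside it.
absClique-bound : length (labels m n) ≢ 1 → AbsCliqueInO m n r → r ≤ suc (length (labels m n) * 3)
absClique-bound p≢1 (k , G , outer , H , clique) =
  NearBound.near-bound (S H) (sublayout H (layout G outer)) k (λ x → toℕ<n (proj₁ outer (emb H x)))
    id (clique⇒Near (S H) clique) p≢1

-- The extremal fan.

next : k ≢ 1 → Fin k → Fin k
next {suc zero}    k≢1 _       = contradiction refl k≢1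
next {suc (suc k)} _   zero    = 1F
next {suc (suc k)} _   (suc _) = 0F

next-≢ : (k≢1 : k ≢ 1) (i : Fin k) → i ≢ next k≢1 i
next-≢ {suc zero}    k≢1 _       = contradiction refl k≢1
next-≢ {suc (suc k)} _   zero    = λ ()
next-≢ {suc (suc k)} _   (suc _) = λ ()

-- A hub joined to p blocks of three vertices, the block b by the label L b; each block is a path
-- whose middle vertex sees its two ends through different labels, which needs p ≢ 1.
module Fan {p} (p≢1 : p ≢ 1) {L : Fin p → Adj m n} (L-inj : Injective _≡_ _≡_ L) (L-≢none : ∀ b → L b ≢ none) where

  path : Fin p → Fin 3 → Fin 3 → Adj m n
  path b 0F 1F = L b
  path b 1F 0F = rev (L b)
  path b 2F 1F = L (next p≢1 b)
  path b 1F 2F = rev (L (next p≢1 b))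
  path b 0F 0F = none
  path b 1F 1F = none
  path b 2F 2F = none
  path b 0F 2F = none
  path b 2F 0F = none

  path-loopless : ∀ b i → path b i i ≡ none
  path-loopless b 0F = refl
  path-loopless b 1F = refl
  path-loopless b 2F = refl

  path-sym : ∀ b i j → path b j i ≡ rev (path b i j)
  path-sym b 0F 0F = refl
  path-sym b 0F 1F = refl
  path-sym b 0F 2F = refl
  path-sym b 1F 0F = sym (rev-involutive _)
  path-sym b 1F 1F = refl
  path-sym b 1F 2F = sym (rev-involutive _)
  path-sym b 2F 0F = refl
  path-sym b 2F 1F = refl
  path-sym b 2F 2F = refl

  path-consecutive : ∀ b i j → path b i j ≢ none → toℕ j ≡ suc (toℕ i) ⊎ toℕ i ≡ suc (toℕ j)
  path-consecutive b 0F 0F ≢ = contradiction refl ≢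
  path-consecutive b 0F 1F _ = inj₁ refl
  path-consecutive b 0F 2F ≢ = contradiction refl ≢
  path-consecutive b 1F 0F _ = inj₂ refl
  path-consecutive b 1F 1F ≢ = contradiction refl ≢
  path-consecutive b 1F 2F _ = inj₁ refl
  path-consecutive b 2F 0F ≢ = contradiction refl ≢
  path-consecutive b 2F 1F _ = inj₂ refl
  path-consecutive b 2F 2F ≢ = contradiction refl ≢

  blockCol : Fin p × Fin 3 → Fin p × Fin 3 → Adj m n
  blockCol (b , i) (c , j) with b ≟ c
  ... | yes _ = path b i j
  ... | no  _ = none

  blockCol-same : ∀ b i j → blockCol (b , i) (b , j) ≡ path b i j
  blockCol-same b i j with b ≟ b
  ... | yes _  = refl
  ... | no b≢b = contradiction refl b≢b

  blockCol-sym : ∀ x y → blockCol y x ≡ rev (blockCol x y)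
  blockCol-sym (b , i) (c , j) with b ≟ c | c ≟ b
  ... | yes refl | yes _   = path-sym b i j
  ... | yes b≡c  | no c≢b  = contradiction (sym b≡c) c≢b
  ... | no b≢c   | yes c≡b = contradiction (sym c≡b) b≢c
  ... | no _     | no _    = refl

  split : Fin (p * 3) → Fin p × Fin 3
  split = Fin.remQuot 3

  fanCol : Fin (suc (p * 3)) → Fin (suc (p * 3)) → Adj m n
  fanCol zero    zero    = none
  fanCol zero    (suc y) = rev (L (proj₁ (split y)))
  fanCol (suc x) zero    = L (proj₁ (split x))
  fanCol (suc x) (suc y) = blockCol (split x) (split y)

  fanGraph : MixedGraph m n (suc (p * 3))
  fanGraph = record { col = fanCol ; loopless = fan-loopless ; sym = fan-sym }
    where
    fan-loopless : ∀ x → fanCol x x ≡ none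
    fan-loopless zero    = refl
    fan-loopless (suc x) = trans (blockCol-same (proj₁ (split x)) (proj₂ (split x)) (proj₂ (split x))) (path-loopless _ (proj₂ (split x)))
    fan-sym : ∀ x y → fanCol y x ≡ rev (fanCol x y)
    fan-sym zero    zero    = refl
    fan-sym zero    (suc y) = sym (rev-involutive _)
    fan-sym (suc x) zero    = refl
    fan-sym (suc x) (suc y) = blockCol-sym (split x) (split y)

  open Chords fanGraph

  fanCol-combine : ∀ b i c j → fanCol (suc (Fin.combine b i)) (suc (Fin.combine c j)) ≡ blockCol (b , i) (c , j)
  fanCol-combine b i c j = cong₂ blockCol (Fin.remQuot-combine b i) (Fin.remQuot-combine c j)

  fanCol-path : ∀ b i j → fanCol (suc (Fin.combine b i)) (suc (Fin.combine b j)) ≡ path b i j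
  fanCol-path b i j = trans (fanCol-combine b i b j) (blockCol-same b i j)

  fanCol-hub : ∀ b i → fanCol (suc (Fin.combine b i)) zero ≡ L b
  fanCol-hub b i = cong (L ∘ proj₁) (Fin.remQuot-combine b i)

  path-near : ∀ b i j → i ≢ j → Near (suc (Fin.combine b i)) (suc (Fin.combine b j))
  path-near b i j i≢j = go i j i≢j
    where
    adjacent : ∀ i j → path b i j ≢ none → suc (Fin.combine b i) ~ suc (Fin.combine b j)
    adjacent i j ≢ eq = ≢ (trans (sym (fanCol-path b i j)) eq)
    ends : Special (suc (Fin.combine b 0F)) (suc (Fin.combine b 1F)) (suc (Fin.combine b 2F))
    ends = adjacent 0F 1F (L-≢none b) , adjacent 2F 1F (L-≢none _) ,
           λ eq → next-≢ p≢1 b (L-inj (trans (sym (fanCol-path b 0F 1F)) (trans eq (fanCol-path b 2F 1F))))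
    go : ∀ i j → i ≢ j → Near (suc (Fin.combine b i)) (suc (Fin.combine b j))
    go 0F 0F i≢j = contradiction refl i≢j
    go 0F 1F _   = inj₁ (adjacent 0F 1F (L-≢none b))
    go 0F 2F _   = inj₂ (suc (Fin.combine b 1F) , ends)
    go 1F 0F _   = inj₁ (adjacent 1F 0F (rev-≢none (L-≢none b)))
    go 1F 1F i≢j = contradiction refl i≢j
    go 1F 2F _   = inj₁ (adjacent 1F 2F (rev-≢none (L-≢none _)))
    go 2F 0F _   = inj₂ (suc (Fin.combine b 1F) , Special-sym {suc (Fin.combine b 0F)} {suc (Fin.combine b 1F)} {suc (Fin.combine b 2F)} ends)
    go 2F 1F _   = inj₁ (adjacent 2F 1F (L-≢none _))
    go 2F 2F i≢j = contradiction refl i≢j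

  -- Vertices of different blocks see the hub through different labels; within a block the path does
  -- the work.
  fan-near : ∀ {x y} → x ≢ y → Near x y
  fan-near {zero}  {zero}  x≢y = contradiction refl x≢y
  fan-near {zero}  {suc y} _   = inj₁ (rev-≢none (L-≢none _))
  fan-near {suc x} {zero}  _   = inj₁ (L-≢none _)
  fan-near {suc x} {suc y} x≢y with Fin.combine-surjective {p} {3} x | Fin.combine-surjective {p} {3} y
  ... | b , i , refl | c , j , refl with b ≟ c
  ...   | yes refl = path-near b i j (x≢y ∘ cong (suc ∘ Fin.combine b))
  ...   | no b≢c   = inj₂ (zero , L-≢none _ , L-≢none _ ,
    λ eq → b≢c (L-inj (trans (sym (fanCol-hub b i)) (trans eq (fanCol-hub c j)))))

  -- `Fin.combine` numbers the rim block by block, so each path runs through three successive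
  -- numbers.
  rim-consecutive : ∀ x y → suc x ~ suc y → toℕ y ≡ suc (toℕ x) ⊎ toℕ x ≡ suc (toℕ y)
  rim-consecutive x y xy with Fin.combine-surjective {p} {3} x | Fin.combine-surjective {p} {3} y
  ... | b , i , refl | c , j , refl with b ≟ c
  ...   | yes refl = Sum.map step step (path-consecutive b i j λ eq → xy (trans (fanCol-path b i j) eq))
    where
    step : ∀ {i j} → toℕ j ≡ suc (toℕ i) → toℕ (Fin.combine b j) ≡ suc (toℕ (Fin.combine b i))
    step {i} {j} eq = trans (Fin.toℕ-combine b j) (trans (cong (3 * toℕ b +_) eq)
      (trans (+-suc _ _) (cong suc (sym (Fin.toℕ-combine b i)))))
  ...   | no b≢c = contradiction (trans (fanCol-combine b i c j) different) xy
    where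
    different : blockCol (b , i) (c , j) ≡ none
    different with b ≟ c
    ... | yes b≡c = contradiction b≡c b≢c
    ... | no _    = refl

  rim-no-gap : ∀ {x y z : Fin (p * 3)} → suc x ~ suc y → toℕ x < toℕ z → ¬ toℕ z < toℕ y
  rim-no-gap {x} {y} xy x<z z<y with rim-consecutive x y xy
  ... | inj₁ y≡1+x = <⇒≱ z<y (≤-trans (≤-reflexive y≡1+x) x<z)
  ... | inj₂ x≡1+y = <⇒≱ (<-trans x<z z<y) (≤-trans (n≤1+n _) (≤-reflexive (sym x≡1+y)))

  -- In the order of the numbering the hub comes first, so in a crossing it could only be `a`. Hence
  -- `c d` or `a b` is a rim edge with a vertex strictly between its ends, though these are
  -- consecutive.
  fan-outerplanar : Outerplanar (Underlying fanGraph)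
  fan-outerplanar = id , id , crossing
    where
    crossing : ∀ a b c d → a ~ b → c ~ d → ¬ (toℕ a < toℕ c × toℕ c < toℕ b × toℕ b < toℕ d)
    crossing zero    (suc b) (suc c) (suc d) _  cd (_ , s≤s c<b , s≤s b<d) = rim-no-gap {c} {d} {b} cd c<b b<d
    crossing (suc a) (suc b) (suc c) _       ab _  (s≤s a<c , s≤s c<b , _) = rim-no-gap {a} {b} {c} ab a<c c<b

  fan-injective : ∀ {l} (H : MixedGraph m n l) {f} → IsHom fanGraph H f → Injective _≡_ _≡_ f
  fan-injective = Near-all⇒hom-injective fanGraph fan-near

  fan-absClique : AbsCliqueInO m n (suc (p * 3))
  fan-absClique = _ , fanGraph , fan-outerplanar ,
    record { emb = id ; emb-inj = id ; S = fanGraph ; sub = λ _ _ → inj₂ refl } ,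
    λ _ H f hom → injective⇒≤ (fan-injective H {f} hom)

  fan-relClique : RelCliqueInO m n (suc (p * 3))
  fan-relClique = _ , fanGraph , fan-outerplanar , id , id , λ _ H f hom _ _ i≢j → i≢j ∘ fan-injective H {f} hom

-- The common value of both parameters.

labels-≢1 : ∀ m n → ¬ (m ≡ 0 × n ≡ 1) → length (labels m n) ≢ 1
labels-≢1 m n ≢01 eq with m | n | trans (sym (length-labels m n)) eq
... | zero  | .1 | refl = ≢01 (refl , refl)
-- One arc colour already accounts for two labels.
... | suc m | n  | eq′ with () ← trans (cong (_+ n) (sym (+-suc m (m + 0)))) (suc-injective eq′)

theorem2 : ∀ (m n : ℕ) → ¬ (m ≡ 0 × n ≡ 1) →
    IsMax (AbsCliqueInO m n) (3 * (2 * m + n) + 1) ×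
    IsMax (RelCliqueInO m n) (3 * (2 * m + n) + 1)
theorem2 m n ≢01 = subst (λ N → IsMax (AbsCliqueInO m n) N × IsMax (RelCliqueInO m n) N) size
  ((fan-absClique , λ _ → absClique-bound p≢1) , (fan-relClique , λ _ → relClique-bound p≢1))
  where
  p≢1 : length (labels m n) ≢ 1
  p≢1 = labels-≢1 m n ≢01
  -- The blocks are indexed by the positions in `labels`, so every label joins exactly one block to
  -- the hub.
  open Fan p≢1 {L = lookup (labels m n)} (lookup-injective (labels-unique m n))
               (λ b → All.lookup (labels-none m n) (∈-lookup b))
  open ≤-Reasoning
  size : suc (length (labels m n) * 3) ≡ 3 * (2 * m + n) + 1
  size = begin-equality
    suc (length (labels m n) * 3)  ≡⟨ cong (λ p → suc (p * 3)) (length-labels m n) ⟩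
    suc ((2 * m + n) * 3)          ≡⟨ cong suc (*-comm (2 * m + n) 3) ⟩
    suc (3 * (2 * m + n))          ≡⟨ +-comm 1 _ ⟩
    3 * (2 * m + n) + 1            ∎
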